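{- Let $G$ be any connected graph and let $U\subseteq V(G)$ be any vertex set. Then exactly one of the following two assertions holds: (i) $G$ contains a star attached to $U$; (ii) there is a locally finite normal tree $T\subseteq G$ that contains $U$ (that is, $U\subseteq V(T)$) and all whose rays are undominated in $G$. Moreover, the normal tree $T$ in (ii) can be chosen such that it contains $U$ cofinally and every component of $G-T$ has finite neighbourhood.
   Context: Graphs may be infinite. A ray is a one-way infinite path. A star attached to $U$ is a subdivided infinite star (a subdivision of a star with infinitely many leaves) contained in $G$ with all its leaves in $U$. A vertex $v$ of $G$ dominates a ray $R\subseteq G$ if there is an infinite $v$--$(R-v)$ fan in $G$, i.e. infinitely many paths from $v$ to $R-v$ that pairwise meet only in $v$; a ray is undominated in $G$ if no vertex of $G$ dominates it. A rooted tree $T$ with root $r$ carries the tree-order: $x\le y$ if $x\in rTy$. A rooted tree $T\subseteq G$ (not necessarily spanning) is normal in $G$ if the endvertices of every $T$-path in $G$ are comparable in the tree-order of $T$, where a $T$-path is a non-trivial path in $G$ whose endvertices but no inner vertices lie in $T$. A tree is locally finite if all its vertices have finite degree. A rooted tree $T\subseteq G$ contains a vertex set $W$ cofinally if $W\subseteq V(T)$ and for every $t\in V(T)$ there is $w\in W$ with $w\ge t$ in the tree-order of $T$. The neighbourhood of a component $C$ of $G-T$ is the set of vertices outside $C$ (hence in $T$) that have a neighbour in $C$.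
   Formalization: That T contains U cofinally is claimed only for non-empty U: for U = ∅ it fails, since a rooted tree contains its root and no vertex of the empty set lies above it; all other claims cover every U. -}

module Defs where

open import Level using (Level; suc; _⊔_)
open import Data.Nat.Base as ℕ using (ℕ)
open import Data.List.Base using (List; []; _∷_; length)
open import Data.List.Membership.Propositional using () renaming (_∈_ to _∈ₗ_)
open import Data.List.Relation.Unary.Unique.Propositional using (Unique)
open import Data.Product.Base using (Σ; ∃-syntax; _×_; _,_; proj₁)
open import Data.Sum.Base using (_⊎_)
open import Data.Unit.Polymorphic.Base using (⊤; tt)
open import Relation.Nullary.Negation using (¬_)
open import Relation.Unary using (Pred; _∈_; _∉_; _⊆_; ∁; Satisfiable)
open import Relation.Binary.Core using (Rel; _⇒_)
open import Relation.Binary.Definitions using (Symmetric; Irreflexive)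
open import Relation.Binary.Construct.Closure.ReflexiveTransitive using (Star; ε; _◅_)
open import Relation.Binary.PropositionalEquality.Core using (_≡_; _≢_)

private
  variable
    a p ℓ : Level

-- Duplicates and superfluous entries in the list are harmless: classically,
-- a subset is finite iff it is covered by a list.
Finite : {A : Set a} → Pred A p → Set (a ⊔ p)
Finite {A = A} P = ∃[ xs ] (∀ {x : A} → x ∈ P → x ∈ₗ xs)

Infinite : Set a → Set a
Infinite {a} A = ¬ Finite {A = A} (λ _ → ⊤ {a})

record Graph (ℓ : Level) : Set (suc ℓ) where
  infix 4 _~_
  field
    Vertex : Set ℓ
    _~_    : Rel Vertex ℓ
    sym    : Symmetric _~_
    irrefl : Irreflexive _≡_ _~_

module _ {V : Set ℓ} {E : Rel V ℓ} where

  vertices : ∀ {x y} → Star E x y → List V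
  vertices {x} ε       = x ∷ []
  vertices {x} (_ ◅ w) = x ∷ vertices w

record Path {V : Set ℓ} (E : Rel V ℓ) (x y : V) : Set ℓ where
  field
    walk   : Star E x y
    unique : Unique (vertices walk)

open Path public

infix 4 _∈ᵖ_

_∈ᵖ_ : {V : Set ℓ} {E : Rel V ℓ} {x y : V} → V → Path E x y → Set ℓ
v ∈ᵖ P = v ∈ₗ vertices (walk P)

-- A path on at least three vertices together with an edge joining its ends.
record Cycle {V : Set ℓ} (E : Rel V ℓ) : Set ℓ where
  field
    {start end} : V
    path        : Path E start end
    long        : 3 ℕ.≤ length (vertices (walk path))
    closing     : E end start

module _ (G : Graph ℓ) where

  open Graph G

  record Subgraph : Set (suc ℓ) where
    field
      verts     : Pred Vertex ℓ
      edge      : Rel Vertex ℓ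
      edge-sym  : Symmetric edge
      edge⇒~    : edge ⇒ _~_
      edge⇒vert : ∀ {x y} → edge x y → x ∈ verts

module _ {G : Graph ℓ} where

  open Graph G
  open Subgraph

  Connected : Subgraph G → Set ℓ
  Connected H = Satisfiable (verts H)
              × (∀ {x y} → x ∈ verts H → y ∈ verts H → Path (edge H) x y)

module _ (G : Graph ℓ) where

  open Graph G

  induced : Pred Vertex ℓ → Subgraph G
  induced X = record
    { verts     = X
    ; edge      = λ x y → x ∈ X × y ∈ X × x ~ y
    ; edge-sym  = λ (x∈X , y∈X , x~y) → y∈X , x∈X , sym x~y
    ; edge⇒~    = λ (_ , _ , x~y) → x~y
    ; edge⇒vert = proj₁
    }

  whole : Subgraph G
  whole = record
    { verts     = λ _ → ⊤
    ; edge      = _~_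
    ; edge-sym  = sym
    ; edge⇒~    = λ x~y → x~y
    ; edge⇒vert = λ _ → tt
    }

  -- C is the vertex set of a component of G[ X ]; note that G[ X ][ C ] = G[ C ].
  record IsComponent (X C : Pred Vertex ℓ) : Set (suc ℓ) where
    field
      C⊆X       : C ⊆ X
      connected : Connected (induced C)
      maximal   : ∀ (D : Pred Vertex ℓ) → D ⊆ X → Connected (induced D) →
                  C ⊆ D → D ⊆ C

  Neighbourhood : Pred Vertex ℓ → Pred Vertex ℓ
  Neighbourhood C v = v ∉ C × ∃[ c ] c ∈ C × v ~ c

  record InfiniteFan (c : Vertex) : Set (suc ℓ) where
    field
      Index    : Set ℓ
      infinite : Infinite Index
      end      : Index → Vertex
      end≢c    : ∀ i → end i ≢ c
      path     : ∀ i → Path _~_ c (end i)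
      disjoint : ∀ {i j} → i ≢ j → ∀ {v} → v ∈ᵖ path i → v ∈ᵖ path j → v ≡ c

  open InfiniteFan

  -- Subdividing an infinite star with centre c replaces its edges by non-trivial
  -- paths from c to the leaves that pairwise meet only in c.
  StarAttachedTo : Pred Vertex ℓ → Set (suc ℓ)
  StarAttachedTo U = ∃[ c ] Σ (InfiniteFan c) λ S → ∀ i → end S i ∈ U

  record Ray (H : Subgraph G) : Set ℓ where
    field
      at        : ℕ → Vertex
      injective : ∀ {m n} → at m ≡ at n → m ≡ n
      step      : ∀ n → Subgraph.edge H (at n) (at (ℕ.suc n))

  -- The ends of the fan lie in R - v, since they differ from v.
  Dominates : {H : Subgraph G} → Vertex → Ray H → Set (suc ℓ)
  Dominates v R = Σ (InfiniteFan v) λ F → ∀ i → ∃[ n ] end F i ≡ Ray.at R n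

  Undominated : {H : Subgraph G} → Ray H → Set (suc ℓ)
  Undominated R = ∀ v → ¬ Dominates v R

  record RootedTree : Set (suc ℓ) where
    field
      subgraph  : Subgraph G
      connected : Connected subgraph

    open Subgraph subgraph public

    field
      acyclic : ¬ Cycle edge
      root    : Vertex
      root∈   : root ∈ verts

    infix 4 _≤_

    _≤_ : Rel Vertex ℓ
    x ≤ y = Σ (Path edge root y) λ P → x ∈ᵖ P

  module _ (T : RootedTree) where

    private module T = RootedTree T

    IsTPath : ∀ {x y} → Path _~_ x y → Set ℓ
    IsTPath {x} {y} P = x ≢ y × x ∈ T.verts × y ∈ T.verts
                      × (∀ {v} → v ∈ᵖ P → v ≢ x → v ≢ y → v ∉ T.verts)

    Normal : Set ℓ
    Normal = ∀ {x y} (P : Path _~_ x y) → IsTPath P → x T.≤ y ⊎ y T.≤ x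

    LocallyFinite : Set ℓ
    LocallyFinite = ∀ {t} → t ∈ T.verts → Finite (T.edge t)

    ContainsCofinally : Pred Vertex ℓ → Set ℓ
    ContainsCofinally W = W ⊆ T.verts
                        × (∀ {t} → t ∈ T.verts → ∃[ w ] w ∈ W × t T.≤ w)

    FiniteNeighbourhoods : Set (suc ℓ)
    FiniteNeighbourhoods = ∀ C → IsComponent (∁ T.verts) C → Finite (Neighbourhood C)

    record IsStarBlockingTree (U : Pred Vertex ℓ) : Set (suc ℓ) where
      field
        locallyFinite : LocallyFinite
        normal        : Normal
        contains      : U ⊆ T.verts
        undominated   : (R : Ray T.subgraph) → Undominated R

{-# OPTIONS --safe #-}
module Submission where

-- If U carries no star, then every vertex v is separated from U in G - v by a finite set
-- S v. Attaching single vertices to the top of the neighbourhood of a component, one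
-- builds an increasing sequence of finite normal trees whose union T contains S v for
-- every v in T. A path from the root to a vertex u of U outside T would leave T for the last
-- time at some t and then avoid S t, so T contains U. Let T′ be the down-closure of U in T;
-- it is again normal. Any walk that leads from a vertex v to a vertex t of T′ and avoids
-- S v can be prolonged upwards in T to U, so t lies below one of the finitely many vertices
-- in S v or below v. Applied to the tree edges at v, to the paths of a fan from v to a ray,
-- and to the walks through a component of G - T adjacent to v, this bounds the degrees
-- in T′, excludes dominated rays, and bounds the neighbourhoods of those components; a
-- component of G - T′ containing t in T has all its neighbours below t by normality.

open import Defs
open import Level using (suc; Lift; lift; lower)
open import Axiom.ExcludedMiddle using (ExcludedMiddle)
open import Data.Empty using (⊥-elim)
open import Data.List.Base using (List; []; _∷_; _++_; concatMap; length)
open import Data.List.Membership.Propositional using () renaming (_∈_ to _∈ₗ_)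
open import Data.List.Membership.Propositional.Properties using (∈-++⁺ˡ; ∈-++⁺ʳ; ∈-concatMap⁺)
open import Data.List.Properties using (∷-injectiveˡ)
open import Data.List.Relation.Unary.All as All using (All; []; _∷_)
open import Data.List.Relation.Unary.Any as Any using (here; there)
open import Data.List.Relation.Unary.Unique.Propositional using ([]; _∷_)
open import Data.Nat.Base using (ℕ; zero; _<_; _⊔_; z≤n; s≤s; _≤′_; ≤′-refl; ≤′-step)
  renaming (suc to 1+_; _≤_ to _≤ⁿ_)
open import Data.Nat.Induction using (<-rec)
open import Data.Nat.Properties as ℕ using (<-cmp; m<1+n⇒m<n∨m≡n; ≤⇒≤′; m≤m⊔n; m≤n⊔m)
open import Data.Product.Base using (Σ; ∃-syntax; _×_; _,_; proj₁; proj₂)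
open import Data.Sum.Base using (_⊎_; inj₁; inj₂; [_,_]′) renaming (map to map-⊎; swap to swap-⊎)
open import Data.Unit.Polymorphic.Base using (tt)
open import Function.Base using (_∘_; id)
open import Relation.Binary.Construct.Closure.ReflexiveTransitive using (Star; ε; _◅_; _◅◅_)
  renaming (map to map-Star; reverse to reverse-Star)
open import Relation.Binary.Core using (Rel)
open import Relation.Binary.Definitions using (tri<; tri≈; tri>)
open import Relation.Binary.PropositionalEquality.Core using (_≡_; _≢_; refl; sym; trans; subst; cong)
open import Relation.Nullary.Decidable using (Dec; yes; no; map′; decidable-stable)
open import Relation.Nullary.Negation using (¬_)
open import Relation.Unary using (Pred; Satisfiable; _∈_; _∉_; _⊆_; ∁)

-- Finite sets

bounded : ∀ {a r} {A : Set a} (R : A → ℕ → Set r) →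
          (∀ x → ∃[ n ] ∀ {m} → R x m → m < n) →
          ∀ xs → ∃[ n ] ∀ {x} → x ∈ₗ xs → ∀ {m} → R x m → m < n
bounded R bound []       = 0 , λ ()
bounded R bound (x ∷ xs) =
  let k , below-k = bound x
      l , below-l = bounded R bound xs
  in k ⊔ l , λ { (here refl) r → ℕ.<-≤-trans (below-k r) (m≤m⊔n k l)
               ; (there i)   r → ℕ.<-≤-trans (below-l i r) (m≤n⊔m k l) }

ℕ-infinite : ∀ {a} → Infinite (Lift a ℕ)
ℕ-infinite (xs , covers) =
  let n , below = bounded (λ x m → x ≡ lift m) (λ x → 1+ lower x , λ { refl → ℕ.≤-refl }) xs
  in ℕ.<-irrefl refl (below (covers {lift n} tt) refl)

finite-⊆ : ∀ {a p q} {A : Set a} {P : Pred A p} {Q : Pred A q} → P ⊆ Q → Finite Q → Finite P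
finite-⊆ P⊆Q (xs , covers) = xs , covers ∘ P⊆Q

finite-∪ : ∀ {a p q} {A : Set a} {P : Pred A p} {Q : Pred A q} →
           Finite P → Finite Q → Finite (λ x → P x ⊎ Q x)
finite-∪ (xs , P⊆xs) (ys , Q⊆ys) =
  xs ++ ys , [ ∈-++⁺ˡ ∘ P⊆xs , ∈-++⁺ʳ xs ∘ Q⊆ys ]′

finite-⋃ : ∀ {a b q} {A : Set a} {B : Set b} {Q : B → Pred A q} (xs : List B) →
           (∀ x → Finite (Q x)) → Finite (λ y → ∃[ x ] x ∈ₗ xs × y ∈ Q x)
finite-⋃ []       fin = [] , λ ()
finite-⋃ (x ∷ xs) fin =
  finite-⊆ (λ { (_ , here refl , q) → inj₁ q ; (z , there i , q) → inj₂ (z , i , q) })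
           (finite-∪ (fin x) (finite-⋃ xs fin))

-- Walks and paths

module _ {ℓ} {V : Set ℓ} {E : Rel V ℓ} where

  start∈vertices : ∀ {x y} (w : Star E x y) → x ∈ₗ vertices w
  start∈vertices ε       = here refl
  start∈vertices (_ ◅ _) = here refl

  end∈vertices : ∀ {x y} (w : Star E x y) → y ∈ₗ vertices w
  end∈vertices ε       = here refl
  end∈vertices (_ ◅ w) = there (end∈vertices w)

  restrict : ∀ {O : Pred V ℓ} {x y} (w : Star E x y) → (∀ {v} → v ∈ₗ vertices w → v ∈ O) →
             Star (λ a b → E a b × b ∈ O) x y
  restrict ε       inO = ε
  restrict (e ◅ w) inO = (e , inO (there (start∈vertices w))) ◅ restrict w (inO ∘ there)

  vertices-restricted : ∀ {O : Pred V ℓ} {x y v} (w : Star (λ a b → E a b × b ∈ O) x y) →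
                        v ∈ₗ vertices (map-Star proj₁ w) → v ≡ x ⊎ v ∈ O
  vertices-restricted ε             (here refl) = inj₁ refl
  vertices-restricted (_ ◅ w)       (here refl) = inj₁ refl
  vertices-restricted ((_ , o) ◅ w) (there i)   with vertices-restricted w i
  ... | inj₁ refl = inj₂ o
  ... | inj₂ o′   = inj₂ o′

  path-from : ∀ {x y z} (P : Path E x y) → z ∈ᵖ P →
              Σ (Path E z y) λ Q → ∀ {v} → v ∈ᵖ Q → v ∈ᵖ P
  path-from P@(record { walk = ε })     (here refl) = P , id
  path-from P@(record { walk = _ ◅ _ }) (here refl) = P , id
  path-from record { walk = e ◅ w ; unique = _ ∷ u } (there i) =
    let Q , Q⊆w = path-from (record { walk = w ; unique = u }) i in Q , there ∘ Q⊆w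

-- Finiteness and walks under excluded middle.

module Classical {ℓ} (em : ExcludedMiddle ℓ) where

  -- Applied to Σ-types this yields actual witnesses, so it doubles as a choice principle.
  stable : ∀ {P : Set ℓ} → ¬ ¬ P → P
  stable = decidable-stable em

  finite-subsingleton : {A : Set ℓ} {P : Pred A ℓ} →
                        (∀ {x y} → x ∈ P → y ∈ P → x ≡ y) → Finite P
  finite-subsingleton {P = P} eq with em {Satisfiable P}
  ... | yes (x , px) = x ∷ [] , λ py → here (eq py px)
  ... | no ¬∃        = [] , λ {x} px → ⊥-elim (¬∃ (x , px))

  infinite-∖-finite : {A : Set ℓ} {P Q : Pred A ℓ} → ¬ Finite P → Finite Q →
                      ∃[ x ] x ∈ P × x ∉ Q
  infinite-∖-finite inf fin = stable λ none →
    inf (finite-⊆ (λ {x} px → stable λ ¬q → none (x , px , ¬q)) fin)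

  pigeonhole : {A B : Set ℓ} {P : Pred A ℓ} {Q : B → Pred A ℓ} (xs : List B) → ¬ Finite P →
               (∀ {y} → y ∈ P → ∃[ x ] x ∈ₗ xs × y ∈ Q x) → ∃[ x ] ¬ Finite (Q x)
  pigeonhole xs inf cover = stable λ none →
    inf (finite-⊆ cover (finite-⋃ xs λ x → stable λ ¬fin → none (x , ¬fin)))

  least : (P : Pred ℕ ℓ) → ∀ {n} → P n → ∃[ m ] P m × (∀ {k} → k < m → ¬ P k)
  least P {n} = <-rec (λ n → P n → Least) (λ n rec pn → case rec pn em) n
    where
    Least = ∃[ m ] P m × (∀ {k} → k < m → ¬ P k)

    case : ∀ {n} → (∀ {k} → k < n → P k → Least) → P n → Dec (∃[ k ] k < n × P k) → Least
    case rec pn (yes (k , k<n , pk)) = rec k<n pk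
    case rec pn (no none)            = _ , pn , λ {k} k<n pk → none (k , k<n , pk)

  -- Loop erasure: if the start recurs on the path found for the rest, only the part from that
  -- occurrence on is kept.
  to-path : {V : Set ℓ} {E : Rel V ℓ} {x y : V} (w : Star E x y) →
            Σ (Path E x y) λ P → ∀ {v} → v ∈ᵖ P → v ∈ₗ vertices w
  to-path ε = record { walk = ε ; unique = [] ∷ [] } , id
  to-path {x = x} (e ◅ w) with to-path w
  ... | P , P⊆w with em {x ∈ᵖ P}
  ...   | yes x∈P = let Q , Q⊆P = path-from P x∈P in Q , there ∘ P⊆w ∘ Q⊆P
  ...   | no  x∉P =
    record { walk = e ◅ walk P ; unique = All.tabulate (λ { i refl → x∉P i }) ∷ unique P }
    , λ { (here eq) → here eq ; (there i) → there (P⊆w i) }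

  -- Fans

  module Fans (G : Graph ℓ) where

    open Graph G renaming (sym to ~-sym)
    open InfiniteFan

    -- `v` stays allowed even when it is in `X`, because the vertices used by earlier paths of a fan
    -- include its centre.
    Guarded : List Vertex → Vertex → Rel Vertex ℓ
    Guarded X v a b = a ~ b × (b ∈ₗ X → b ≡ v)

    -- Each new path is chosen to avoid all the previous ones.
    fan : ∀ {v} {A : Pred Vertex ℓ} →
          (∀ X → ∃[ a ] a ∈ A × a ≢ v × Star (Guarded X v) v a) →
          Σ (InfiniteFan G v) λ F → ∀ i → end F i ∈ A
    fan {v} {A} walk-avoiding = record
      { Index    = Lift ℓ ℕ
      ; infinite = ℕ-infinite
      ; end      = λ i → proj₁ (choice (lower i))
      ; end≢c    = λ i → proj₁ (proj₂ (proj₂ (choice (lower i))))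
      ; path     = λ i → proj₁ (chosen (lower i))
      ; disjoint = λ i≢j → disjoint′ (i≢j ∘ cong lift)
      } , λ i → proj₁ (proj₂ (choice (lower i)))
      where
      path-avoiding : ∀ X → Σ (Path _~_ v (proj₁ (walk-avoiding X))) λ P →
                      ∀ {x} → x ∈ᵖ P → x ∈ₗ X → x ≡ v
      path-avoiding X =
        let _ , _ , _ , w = walk-avoiding X
            P , P⊆w = to-path (map-Star proj₁ w)
        in P , λ i x∈X → [ id , (λ guard → guard x∈X) ]′ (vertices-restricted w (P⊆w i))

      used : ℕ → List Vertex
      used zero   = []
      used (1+ n) = vertices (walk (proj₁ (path-avoiding (used n)))) ++ used n

      choice = λ n → walk-avoiding (used n)
      chosen = λ n → path-avoiding (used n)

      ∈-used : ∀ {m n x} → m < n → x ∈ᵖ proj₁ (chosen m) → x ∈ₗ used n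
      ∈-used {n = 1+ n} m<1+n i with m<1+n⇒m<n∨m≡n m<1+n
      ... | inj₁ m<n  = ∈-++⁺ʳ (vertices (walk (proj₁ (chosen n)))) (∈-used m<n i)
      ... | inj₂ refl = ∈-++⁺ˡ i

      disjoint′ : ∀ {m n} → m ≢ n → ∀ {x} →
                  x ∈ᵖ proj₁ (chosen m) → x ∈ᵖ proj₁ (chosen n) → x ≡ v
      disjoint′ {m} {n} m≢n i j with <-cmp m n
      ... | tri< m<n _ _ = proj₂ (chosen n) j (∈-used m<n i)
      ... | tri≈ _ m≡n _ = ⊥-elim (m≢n m≡n)
      ... | tri> _ _ n<m = proj₂ (chosen m) i (∈-used n<m j)

    Meets : ∀ {c} (F : InfiniteFan G c) → List Vertex → Pred (Index F) ℓ
    Meets {c} F X i = ∃[ x ] x ∈ₗ X × x ≢ c × x ∈ᵖ path F i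

    -- By disjointness, each vertex other than `c` lies on at most one path of the fan.
    meets-finite : ∀ {c} (F : InfiniteFan G c) X → Finite (Meets F X)
    meets-finite F X = finite-⋃ X λ x → finite-subsingleton λ (x≢c , i∋x) (_ , j∋x) →
      stable λ i≢j → x≢c (disjoint F i≢j i∋x j∋x)

    ends-in-finite : ∀ {c} (F : InfiniteFan G c) X → Finite (λ i → end F i ∈ₗ X)
    ends-in-finite F X =
      finite-⊆ (λ {i} e∈X → end F i , e∈X , end≢c F i , end∈vertices (walk (path F i)))
               (meets-finite F X)

    guarded-path : ∀ {c} (F : InfiniteFan G c) {X i} → i ∉ Meets F X →
                   Star (Guarded X c) c (end F i)
    guarded-path F {i = i} avoids = restrict (walk (path F i)) λ {x} x∈P x∈X →
      stable λ x≢c → avoids (x , x∈X , x≢c , x∈P)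

    -- A star and a blocking tree exclude each other: König's lemma, applied to the
    -- breadth-first levels of the tree, yields a ray dominated by the centre of the star.
    module Exclusion {U : Pred Vertex ℓ} (T : RootedTree G) (blocking : IsStarBlockingTree G T U)
                     {c : Vertex} (F : InfiniteFan G c) (ends∈U : ∀ i → end F i ∈ U) where

      open RootedTree T using (edge; edge-sym; edge⇒~; edge⇒vert; root; root∈; connected; subgraph)
      open IsStarBlockingTree blocking

      Reach : ℕ → Pred Vertex ℓ
      Reach zero   x = x ≡ root
      Reach (1+ n) x = ∃[ y ] y ∈ Reach n × edge y x

      Dist : ℕ → Pred Vertex ℓ
      Dist n x = x ∈ Reach n × (∀ {k} → k < n → x ∉ Reach k)

      Dist-unique : ∀ {m n x} → x ∈ Dist m → x ∈ Dist n → m ≡ n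
      Dist-unique {m} {n} (reach-m , min-m) (reach-n , min-n) with <-cmp m n
      ... | tri< m<n _ _ = ⊥-elim (min-n m<n reach-m)
      ... | tri≈ _ m≡n _ = m≡n
      ... | tri> _ _ n<m = ⊥-elim (min-m n<m reach-n)

      -- Distance from the root orients the edges; each step raises it by one, so a walk never
      -- returns to an earlier level.
      Away : Rel Vertex ℓ
      Away x y = edge x y × ∃[ n ] x ∈ Dist n × y ∈ Dist (1+ n)

      away-from-root : ∀ n {x} → x ∈ Dist n → Star Away root x
      away-from-root zero   (refl , _) = ε
      away-from-root (1+ n) {x} ((y , reach , e) , min) =
        away-from-root n dist-y ◅◅ ((e , n , dist-y , (y , reach , e) , min) ◅ ε)
        where
        dist-y : y ∈ Dist n
        dist-y = reach , λ k<n r → min (s≤s k<n) (y , r , e)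

      reachable : ∀ {x y n} → x ∈ Reach n → Star edge x y → ∃[ m ] y ∈ Reach m
      reachable r ε       = _ , r
      reachable r (e ◅ w) = reachable (_ , r , e) w

      away : ∀ {x} → x ∈ U → Star Away root x
      away x∈U =
        let n , dist = least _ (proj₂ (reachable {n = 0} refl
                                        (walk (proj₂ connected root∈ (contains x∈U)))))
        in away-from-root n dist

      Beyond : Vertex → Pred (Index F) ℓ
      Beyond t i = Star Away t (end F i)

      Node : ℕ → Set ℓ
      Node n = ∃[ t ] t ∈ Dist n × ¬ Finite (Beyond t)

      -- The König step: apart from the finitely many fan paths ending at `t`, every end beyond `t`
      -- is reached through one of the finitely many neighbours of `t`.
      next : ∀ {n} (t : Node n) → ∃[ t′ ] edge (proj₁ t) t′ × t′ ∈ Dist (1+ n) × ¬ Finite (Beyond t′)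
      next {n} (t , dist , inf) with pigeonhole {P = λ i → i ∈ Beyond t × i ∉ ends-at-t}
                                       {Q = λ s i → Away t s × i ∈ Beyond s}
                                       (proj₁ children) inf′ first-step
        where
        ends-at-t : Pred (Index F) ℓ
        ends-at-t i = end F i ∈ₗ t ∷ []

        inf′ : ¬ Finite (λ i → i ∈ Beyond t × i ∉ ends-at-t)
        inf′ fin = inf (finite-⊆ (λ {i} b → split (em {i ∈ ends-at-t}) b)
                                 (finite-∪ (ends-in-finite F (t ∷ [])) fin))
          where
          split : ∀ {i} → Dec (i ∈ ends-at-t) → i ∈ Beyond t →
                  i ∈ ends-at-t ⊎ (i ∈ Beyond t × i ∉ ends-at-t)
          split (yes at-t) b = inj₁ at-t
          split (no ¬at-t) b = inj₂ (b , ¬at-t)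

        t∈T : ∀ {m x} → x ∈ Dist m → x ∈ RootedTree.verts T
        t∈T {zero}  (refl , _) = root∈
        t∈T {1+ m} ((_ , _ , e) , _) = edge⇒vert (edge-sym e)

        children : Finite (edge t)
        children = locallyFinite (t∈T dist)

        first-step : ∀ {i} → i ∈ Beyond t × i ∉ ends-at-t →
                     ∃[ s ] s ∈ₗ proj₁ children × Away t s × i ∈ Beyond s
        first-step {i} (w , ¬at-t) = go w refl
          where
          go : ∀ {x} → Star Away t x → x ≡ end F i →
               ∃[ s ] s ∈ₗ proj₁ children × Away t s × Star Away s (end F i)
          go ε       eq   = ⊥-elim (¬at-t (here (sym eq)))
          go (a ◅ w) refl = _ , proj₂ children (proj₁ a) , a , w
      ... | s , inf-s with em {Away t s}
      -- Without an `Away` edge to `s`, the class of `s` would be empty.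
      ...   | no ¬a = ⊥-elim (inf-s ([] , λ (a , _) → ⊥-elim (¬a a)))
      ...   | yes a@(e , m , dist-m , dist-s) =
        s , e , subst (λ k → s ∈ Dist (1+ k)) (Dist-unique dist-m dist) dist-s
          , λ fin → inf-s (finite-⊆ proj₂ fin)

      node : ∀ n → Node n
      node zero = root , (refl , λ ()) ,
        λ (is , covers) → infinite F (is , λ {i} _ → covers {i} (away (ends∈U i)))
      node (1+ n) = let t , _ , t-node = next (node n) in t , t-node

      ray : Ray G subgraph
      ray = record
        { at        = proj₁ ∘ node
        ; injective = λ {m} {n} eq →
            Dist-unique (subst (_∈ Dist m) eq (proj₁ (proj₂ (node m)))) (proj₁ (proj₂ (node n)))
        ; step      = λ n → proj₁ (proj₂ (next (node n)))
        }

      -- `X` lies before level `n`, while an `Away` walk from level `n` or later only moves further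
      -- out; so its reverse avoids `X`.
      back : ∀ {X n} → (∀ {x} → x ∈ₗ X → ∀ {m} → x ∈ Dist m → m < n) →
             ∀ {m x y} → x ∈ Dist m → n ≤ⁿ m → Star Away x y →
             Star (λ a b → a ~ b × ¬ b ∈ₗ X) y x
      back near dist n≤m ε = ε
      back near dist n≤m ((e , k , dist-k , dist-z) ◅ w) with Dist-unique dist dist-k
      ... | refl = back near dist-z (ℕ.m≤n⇒m≤1+n n≤m) w
                ◅◅ ((~-sym (edge⇒~ e) , λ x∈X → ℕ.<⇒≱ (near x∈X dist) n≤m) ◅ ε)

      Dist-bounded : ∀ x → ∃[ n ] ∀ {m} → x ∈ Dist m → m < n
      Dist-bounded x with em {∃[ m ] x ∈ Dist m}
      ... | yes (m , dist) = 1+ m , λ dist′ → ℕ.≤-reflexive (cong 1+_ (Dist-unique dist′ dist))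
      ... | no ¬∃          = 0 , λ {m} dist → ⊥-elim (¬∃ (m , dist))

      -- Infinitely many fan paths end beyond a ray vertex `t` that is farther out than `X`. One
      -- that avoids `X` is followed to its end, and from there the tree leads back to `t`.
      dominates : Dominates G c ray
      dominates = fan {A = λ x → ∃[ n ] x ≡ Ray.at ray n} λ X →
        -- Adding `c` to `X` ensures that `t` differs from `c` as well.
        let n , near = bounded (λ x m → x ∈ Dist m) Dist-bounded (c ∷ X)
            t , dist , inf = node n
            i , w , avoids = infinite-∖-finite inf (meets-finite F X)
        in t , (n , refl) , (λ t≡c → ℕ.<-irrefl refl (near (here t≡c) dist))
             , guarded-path F avoids
               ◅◅ map-Star (λ (a , b∉) → a , λ b∈X → ⊥-elim (b∉ (there b∈X)))
                           (back near dist ℕ.≤-refl w)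

    exclusive : ∀ {U} → ¬ (StarAttachedTo G U × (∃[ T ] IsStarBlockingTree G T U))
    exclusive ((c , F , ends∈U) , T , blocking) =
      IsStarBlockingTree.undominated blocking ray c dominates
      where open Exclusion T blocking F ends∈U

  -- Normal trees

  module Trees (G : Graph ℓ) (root : Graph.Vertex G) where

    open Graph G renaming (sym to ~-sym)

    -- A rooted tree is given by its branches: x ∷ zs lists a vertex x followed by its
    -- proper predecessors in descending order.
    record BranchTree : Set (suc ℓ) where
      field
        Branch      : Pred (List Vertex) ℓ
        root-branch : Branch (root ∷ [])
        root-only   : ∀ {x} → Branch (x ∷ []) → x ≡ root
        parent      : ∀ {x y zs} → Branch (x ∷ y ∷ zs) → Branch (y ∷ zs) × x ~ y
        once        : ∀ {x ys zs} → Branch (x ∷ ys) → Branch (x ∷ zs) → ys ≡ zs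

      infix 4 _≼_ _⋠_

      verts : Pred Vertex ℓ
      verts x = ∃[ zs ] Branch (x ∷ zs)

      _≼_ _⋠_ : Rel Vertex ℓ
      x ≼ y = ∃[ zs ] Branch (y ∷ zs) × x ∈ₗ y ∷ zs
      x ⋠ y = ¬ x ≼ y

      Child : Rel Vertex ℓ
      Child x y = ∃[ zs ] Branch (y ∷ x ∷ zs)

      Comparable : Rel Vertex ℓ
      Comparable x y = x ≼ y ⊎ y ≼ x

      branch-from : ∀ {x y zs} → Branch (y ∷ zs) → x ∈ₗ y ∷ zs →
                    ∃[ ws ] Branch (x ∷ ws) × (∀ {z} → z ∈ₗ x ∷ ws → z ∈ₗ y ∷ zs)
                          × length ws ≤ⁿ length zs
      branch-from b (here refl) = _ , b , id , ℕ.≤-refl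
      branch-from {zs = _ ∷ _} b (there i) =
        let ws , b′ , ws⊆ , len = branch-from (proj₁ (parent b)) i
        in ws , b′ , there ∘ ws⊆ , ℕ.m≤n⇒m≤1+n len

      root∈branch : ∀ {x zs} → Branch (x ∷ zs) → root ∈ₗ x ∷ zs
      root∈branch {zs = []}    b = here (sym (root-only b))
      root∈branch {zs = _ ∷ _} b = there (root∈branch (proj₁ (parent b)))

      ≼-branch : ∀ {x y zs} → Branch (y ∷ zs) → x ≼ y → x ∈ₗ y ∷ zs
      ≼-branch b (_ , b′ , i) with once b b′
      ... | refl = i

      ≼-refl : ∀ {x} → x ∈ verts → x ≼ x
      ≼-refl (_ , b) = _ , b , here refl

      ≼-trans : ∀ {x y z} → x ≼ y → y ≼ z → x ≼ z
      ≼-trans x≼y (_ , b , i) =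
        let _ , b′ , sub , _ = branch-from b i in _ , b , sub (≼-branch b′ x≼y)

      ≼⇒verts : ∀ {x y} → x ≼ y → x ∈ verts
      ≼⇒verts (_ , b , i) = let ws , b′ , _ = branch-from b i in ws , b′

      child-≼ : ∀ {x y} → Child x y → x ≼ y
      child-≼ (_ , b) = _ , b , there (here refl)

      -- Otherwise `y` would have a branch inside that of `x`, shorter than its unique branch.
      child-⋠ : ∀ {x y} → Child x y → y ⋠ x
      child-⋠ (_ , b) y≼x with branch-from (proj₁ (parent b)) (≼-branch (proj₁ (parent b)) y≼x)
      ... | _ , b′ , _ , len with once b b′
      ...   | refl = ℕ.<-irrefl refl len

      ≼-child : ∀ {x y z} → Child y z → x ≼ z → x ≢ z → x ≼ y
      ≼-child (_ , b) x≼z x≢z with ≼-branch b x≼z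
      ... | here x≡z = ⊥-elim (x≢z x≡z)
      ... | there i  = _ , proj₁ (parent b) , i

      chain : ∀ {x y z} → x ≼ z → y ≼ z → Comparable x y
      chain x≼z y≼z@(_ , b , _) = go b (≼-branch b x≼z) (≼-branch b y≼z)
        where
        go : ∀ {x y z zs} → Branch (z ∷ zs) → x ∈ₗ z ∷ zs → y ∈ₗ z ∷ zs → Comparable x y
        go b (here refl) j           = inj₂ (_ , b , j)
        go b i           (here refl) = inj₁ (_ , b , i)
        go {zs = _ ∷ _} b (there i) (there j) = go (proj₁ (parent b)) i j

      climb : ∀ {x y} → x ≼ y → Star (λ a b → Child a b × x ≼ b) x y
      climb (_ , b , i) = go b i
        where
        go : ∀ {x y zs} → Branch (y ∷ zs) → x ∈ₗ y ∷ zs → Star (λ a b → Child a b × x ≼ b) x y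
        go b (here refl) = ε
        go {zs = _ ∷ _} b (there i) = go (proj₁ (parent b)) i ◅◅ (((_ , b) , _ , b , there i) ◅ ε)

      child-~ : ∀ {x y} → Child x y → x ~ y
      child-~ (_ , b) = ~-sym (proj₂ (parent b))

      below-finite : ∀ xs → Finite (λ x → ∃[ y ] y ∈ₗ xs × x ≼ y)
      below-finite xs = finite-⋃ xs below
        where
        below : ∀ y → Finite (_≼ y)
        below y with em {y ∈ verts}
        ... | yes (zs , b) = y ∷ zs , ≼-branch b
        ... | no y∉T       = [] , λ (_ , b , _) → ⊥-elim (y∉T (_ , b))

    -- Treks and normality.

    open BranchTree using (Branch)

    -- The walk version of a `T`-path: at least one edge, inner vertices outside `N`, ends
    -- arbitrary. Allowing repetitions lets treks be joined at any vertex outside `N`.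
    data Trek (N : Pred Vertex ℓ) : Rel Vertex ℓ where
      last : ∀ {x y} → x ~ y → Trek N x y
      step : ∀ {x y z} → x ~ y → y ∉ N → Trek N y z → Trek N x z

    module _ {N : Pred Vertex ℓ} where

      size : ∀ {x y} → Trek N x y → ℕ
      size (last _)     = 0
      size (step _ _ p) = 1+ size p

      join : ∀ {x y z} → Trek N x y → y ∉ N → Trek N y z → Trek N x z
      join (last e)     y∉N q = step e y∉N q
      join (step e o p) y∉N q = step e o (join p y∉N q)

      reverse : ∀ {x y} → Trek N x y → Trek N y x
      reverse (last e)     = last (~-sym e)
      reverse (step e o p) = join (reverse p) o (last (~-sym e))

      trek-⊇ : ∀ {M : Pred Vertex ℓ} → M ⊆ N → ∀ {x y} → Trek N x y → Trek M x y
      trek-⊇ M⊆N (last e)     = last e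
      trek-⊇ M⊆N (step e o p) = step e (o ∘ M⊆N) (trek-⊇ M⊆N p)

    verts : BranchTree → Pred Vertex ℓ
    verts = BranchTree.verts

    Below : BranchTree → Rel Vertex ℓ
    Below = BranchTree._≼_

    syntax Below T x y = x ≼[ T ] y

    Normal′ : BranchTree → Set ℓ
    Normal′ T = ∀ {x y} → x ∈ verts T → y ∈ verts T → Trek (verts T) x y →
                BranchTree.Comparable T x y

    infix 4 _⊑_

    _⊑_ : Rel BranchTree ℓ
    S ⊑ T = ∀ {zs} → Branch S zs → Branch T zs

    verts-mono : ∀ {S T} → S ⊑ T → verts S ⊆ verts T
    verts-mono S⊑T (zs , b) = zs , S⊑T b

    ≼-mono : ∀ {S T} → S ⊑ T → ∀ {x y} → x ≼[ S ] y → x ≼[ T ] y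
    ≼-mono S⊑T (zs , b , i) = zs , S⊑T b , i

    comparable-mono : ∀ {S T} → S ⊑ T → ∀ {x y} →
                      BranchTree.Comparable S x y → BranchTree.Comparable T x y
    comparable-mono {S} {T} S⊑T = map-⊎ (≼-mono {S} {T} S⊑T) (≼-mono {S} {T} S⊑T)

    -- `t` is the last vertex of the walk in `N`; the first alternative of `go` records that the
    -- part seen so far, from the far end, has not met `N`.
    exit : ∀ {N : Pred Vertex ℓ} {x y} → x ∈ N → y ∉ N → Star _~_ x y →
           ∃[ t ] t ∈ N × Trek N t y
    exit {N} {y = y} x∈N y∉N w = [ (λ (x∉N , _) → ⊥-elim (x∉N x∈N)) , id ]′ (go w)
      where
      go : ∀ {x} → Star _~_ x y →
           (x ∉ N × (x ≡ y ⊎ Trek N x y)) ⊎ (∃[ t ] t ∈ N × Trek N t y)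
      go ε = inj₁ (y∉N , inj₁ refl)
      go {x} (e ◅ w) with go w
      ... | inj₂ r         = inj₂ r
      ... | inj₁ (z∉N , q) with em {x ∈ N} | [ (λ { refl → last e }) , step e z∉N ]′ q
      ...   | yes x∈N | p = inj₂ (x , x∈N , p)
      ...   | no  x∉N | p = inj₁ (x∉N , inj₂ p)

    -- Grafting vertices onto normal trees.

    module Graft (T : BranchTree) {t ts v} (b : Branch T (t ∷ ts)) (v∉T : v ∉ verts T)
                 (t~v : t ~ v) where

      private module T = BranchTree T

      graft : BranchTree
      graft = record
        { Branch      = λ zs → Branch T zs ⊎ zs ≡ v ∷ t ∷ ts
        ; root-branch = inj₁ T.root-branch
        ; root-only   = λ { (inj₁ b′) → T.root-only b′ }
        ; parent      = λ { (inj₁ b′) → let b″ , e = T.parent b′ in inj₁ b″ , e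
                          ; (inj₂ refl) → inj₁ b , ~-sym t~v }
        ; once        = λ { (inj₁ b′) (inj₁ b″) → T.once b′ b″
                          ; (inj₁ b′) (inj₂ refl) → ⊥-elim (v∉T (_ , b′))
                          ; (inj₂ refl) (inj₁ b″) → ⊥-elim (v∉T (_ , b″))
                          ; (inj₂ refl) (inj₂ refl) → refl }
        }

      T⊆graft : T.verts ⊆ verts graft
      T⊆graft = verts-mono {T} {graft} inj₁

      v-branch : Branch graft (v ∷ t ∷ ts)
      v-branch = inj₂ refl

      v≼v : v ≼[ graft ] v
      v≼v = _ , v-branch , here refl

      graft-verts : ∀ {x} → x ∈ verts graft → x ∈ T.verts ⊎ x ≡ v
      graft-verts (_ , inj₁ b)    = inj₁ (_ , b)
      graft-verts (_ , inj₂ refl) = inj₂ refl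

      graft-finite : Finite T.verts → Finite (verts graft)
      graft-finite (xs , covers) = v ∷ xs , [ there ∘ covers , here ]′ ∘ graft-verts

      ≼-graft : ∀ {x} → x T.≼ t → x ≼[ graft ] v
      ≼-graft x≼t = _ , v-branch , there (T.≼-branch b x≼t)

      -- A trek avoiding the larger tree also avoids `T`, so only the pairs involving `v` are new.
      graft-normal : Normal′ T → (∀ {w} → w ∈ T.verts → Trek T.verts v w → w T.≼ t) →
                     Normal′ graft
      graft-normal normal below {x} {y} x∈ y∈ p = cases (graft-verts x∈) (graft-verts y∈)
        where
        p′ : Trek T.verts x y
        p′ = trek-⊇ T⊆graft p

        cases : x ∈ T.verts ⊎ x ≡ v → y ∈ T.verts ⊎ y ≡ v → BranchTree.Comparable graft x y
        cases (inj₁ x∈T)  (inj₁ y∈T)  = comparable-mono {T} {graft} inj₁ (normal x∈T y∈T p′)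
        cases (inj₁ x∈T)  (inj₂ refl) = inj₁ (≼-graft (below x∈T (reverse p′)))
        cases (inj₂ refl) (inj₁ y∈T)  = inj₂ (≼-graft (below y∈T p′))
        cases (inj₂ refl) (inj₂ refl) = inj₁ v≼v

      -- If the trek passes through `v`, it is cut at its last visit there. The size bound feeds the
      -- induction in `absorb-along`.
      restart : ∀ {a s} (p : Trek T.verts a s) →
                (Σ (Trek (verts graft) a s) λ q → size q ≤ⁿ size p) ⊎
                (Σ (Trek (verts graft) v s) λ q → size q ≤ⁿ size p)
      restart (last e) = inj₁ (last e , z≤n)
      restart (step {y = y} e y∉T p) with restart p
      ... | inj₂ (q , q≤p) = inj₂ (q , ℕ.m≤n⇒m≤1+n q≤p)
      ... | inj₁ (q , q≤p) with em {y ≡ v}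
      ...   | yes refl = inj₂ (q , ℕ.m≤n⇒m≤1+n q≤p)
      ...   | no  y≢v  = inj₁ (step e ([ y∉T , y≢v ]′ ∘ graft-verts) q , s≤s q≤p)

    record FiniteNormalTree : Set (suc ℓ) where
      field
        tree   : BranchTree
        finite : Finite (verts tree)
        normal : Normal′ tree

      -- For `s` outside the tree, this bounds all neighbours of the component containing `s`.
      Top : Vertex → Pred Vertex ℓ
      Top s t = ∀ {w} → w ∈ verts tree → Trek (verts tree) w s → w ≼[ tree ] t

    open FiniteNormalTree

    -- The trek from t to s is followed until s is absorbed. Its start t stays the
    -- top of the neighbours of the component containing s, which keeps the tree normal.
    absorb-along : ∀ n F {t ts s} → Branch (tree F) (t ∷ ts) → s ∉ verts (tree F) → Top F s t →
                   (p : Trek (verts (tree F)) t s) → size p ≤ⁿ n →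
                   Σ FiniteNormalTree λ F′ → tree F ⊑ tree F′ × s ∈ verts (tree F′)
    absorb-along n F {s = s} b s∉T top (last t~s) _ =
      record { tree   = graft
             ; finite = graft-finite (finite F)
             ; normal = graft-normal (normal F) (λ w∈T → top w∈T ∘ reverse)
             } , inj₁ , _ , v-branch
      where open Graft (tree F) b s∉T t~s
    absorb-along (1+ n) F {s = s} b s∉T top (step {y = v} t~v v∉T p) (s≤s p≤n) = continue em
      where
      open Graft (tree F) b v∉T t~v

      F′ : FiniteNormalTree
      F′ = record
        { tree   = graft
        ; finite = graft-finite (finite F)
        ; normal = graft-normal (normal F) (λ w∈T q → top w∈T (join (reverse q) v∉T p))
        }

      top′ : Top F′ s v
      top′ w∈T′ q with graft-verts w∈T′
      ... | inj₁ w∈T  = ≼-graft (top w∈T (trek-⊇ T⊆graft q))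
      ... | inj₂ refl = v≼v

      continue : Dec (s ∈ verts graft) →
                 Σ FiniteNormalTree λ F″ → tree F ⊑ tree F″ × s ∈ verts (tree F″)
      -- The next vertex `v` may already be `s`.
      continue (yes s∈T′) = F′ , inj₁ , s∈T′
      continue (no s∉T′) =
        -- As `p` itself starts at `v`, both alternatives of `restart` give a trek from `v`.
        let q , q≤p = [ id , id ]′ (restart p)
            F″ , F′⊑F″ , s∈T″ = absorb-along n F′ v-branch s∉T′ top′ q (ℕ.≤-trans q≤p p≤n)
        in F″ , F′⊑F″ ∘ inj₁ , s∈T″

    maximum : ∀ T {P : Pred Vertex ℓ} (xs : List Vertex) →
              (∀ {x y} → x ∈ P → y ∈ P → BranchTree.Comparable T x y) → Satisfiable P →
              ∃[ t ] t ∈ P × (∀ {x} → x ∈ₗ xs → x ∈ P → x ≼[ T ] t)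
    maximum T [] comparable (t , t∈P) = t , t∈P , λ ()
    maximum T {P} (x ∷ xs) comparable inhabited with maximum T xs comparable inhabited | em {x ∈ P}
    ... | t , t∈P , max | no x∉P =
      t , t∈P , λ { (here refl) x∈P → ⊥-elim (x∉P x∈P) ; (there i) → max i }
    ... | t , t∈P , max | yes x∈P with comparable x∈P t∈P
    ...   | inj₁ x≼t = t , t∈P , λ { (here refl) _ → x≼t ; (there i) → max i }
    ...   | inj₂ t≼x = x , x∈P , λ { (here refl) _ → [ id , id ]′ (comparable x∈P x∈P)
                                   ; (there i) y∈P → BranchTree.≼-trans T (max i y∈P) t≼x }

    -- Growing finite normal trees to a closed limit.

    module Growth (connect : ∀ x → Star _~_ root x) where

      -- Treks from two tree vertices to `s` join at `s`, so normality makes the neighbours of its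
      -- component a finite chain, whose maximum is the top required by `absorb-along`.
      absorb : ∀ F s → Σ FiniteNormalTree λ F′ → tree F ⊑ tree F′ × s ∈ verts (tree F′)
      absorb F s with em {s ∈ verts (tree F)}
      ... | yes s∈T = F , id , s∈T
      ... | no s∉T =
        let t , (t∈T , p) , max = maximum (tree F) (proj₁ (finite F))
              (λ (x∈T , p) (y∈T , q) → normal F x∈T y∈T (join p s∉T (reverse q)))
              (exit (_ , BranchTree.root-branch (tree F)) s∉T (connect s))
        in absorb-along (size p) F (proj₂ t∈T) s∉T
             (λ w∈T q → max (proj₂ (finite F) w∈T) (w∈T , q)) p ℕ.≤-refl

      absorb-all : ∀ F ss → Σ FiniteNormalTree λ F′ →
                   tree F ⊑ tree F′ × (∀ {s} → s ∈ₗ ss → s ∈ verts (tree F′))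
      absorb-all F []       = F , id , λ ()
      absorb-all F (s ∷ ss) =
        let F₁ , F⊑F₁ , s∈F₁ = absorb F s
            F₂ , F₁⊑F₂ , ss∈F₂ = absorb-all F₁ ss
        in F₂ , F₁⊑F₂ ∘ F⊑F₁
              , λ { (here refl) → verts-mono {tree F₁} {tree F₂} F₁⊑F₂ s∈F₁ ; (there i) → ss∈F₂ i }

      singleton : FiniteNormalTree
      singleton = record
        { tree   = record
          { Branch      = _≡ root ∷ []
          ; root-branch = refl
          ; root-only   = λ { refl → refl }
          ; parent      = λ ()
          ; once        = λ { refl refl → refl }
          }
        ; finite = root ∷ [] , λ { (_ , refl) → here refl }
        ; normal = λ { (_ , refl) (_ , refl) _ → inj₁ (_ , refl , here refl) }
        }

      module Closure (S : Vertex → List Vertex) where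

        grow : ∀ F → Σ FiniteNormalTree λ F′ →
               tree F ⊑ tree F′ × (∀ {s} → s ∈ₗ concatMap S (proj₁ (finite F)) → s ∈ verts (tree F′))
        grow F = absorb-all F (concatMap S (proj₁ (finite F)))

        stage : ℕ → FiniteNormalTree
        stage zero   = singleton
        stage (1+ n) = proj₁ (grow (stage n))

        stage-mono : ∀ {m n} → m ≤′ n → tree (stage m) ⊑ tree (stage n)
        stage-mono ≤′-refl               = id
        stage-mono (≤′-step {n = n} m≤n) = proj₁ (proj₂ (grow (stage n))) ∘ stage-mono m≤n

        lift-left : ∀ m n → tree (stage m) ⊑ tree (stage (m ⊔ n))
        lift-left m n = stage-mono (≤⇒≤′ (m≤m⊔n m n))

        lift-right : ∀ m n → tree (stage n) ⊑ tree (stage (m ⊔ n))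
        lift-right m n = stage-mono (≤⇒≤′ (m≤n⊔m m n))

        -- The union of the stages; any two branches already lie in a common stage.
        limit : BranchTree
        limit = record
          { Branch      = λ zs → ∃[ n ] Branch (tree (stage n)) zs
          ; root-branch = 0 , refl
          ; root-only   = λ (n , b) → BranchTree.root-only (tree (stage n)) b
          ; parent      = λ (n , b) → let b′ , e = BranchTree.parent (tree (stage n)) b
                                      in (n , b′) , e
          ; once        = λ (m , b) (n , b′) → BranchTree.once (tree (stage (m ⊔ n)))
                                                 (lift-left m n b) (lift-right m n b′)
          }

        stage-⊑ : ∀ n → tree (stage n) ⊑ limit
        stage-⊑ n b = n , b

        stage-verts : ∀ n → verts (tree (stage n)) ⊆ verts limit
        stage-verts n = verts-mono {tree (stage n)} {limit} (stage-⊑ n)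

        limit-closed : ∀ {v s} → v ∈ verts limit → s ∈ₗ S v → s ∈ verts limit
        limit-closed (zs , n , b) s∈Sv = stage-verts (1+ n) (proj₂ (proj₂ (grow (stage n)))
          (∈-concatMap⁺ S (Any.map (λ { refl → s∈Sv }) (proj₂ (finite (stage n)) (zs , b)))))

        -- A trek avoiding the limit avoids the stage that contains both its ends, and that stage is
        -- normal.
        limit-normal : Normal′ limit
        limit-normal (xs , m , b) (ys , n , b′) p =
          comparable-mono {tree (stage (m ⊔ n))} {limit} (stage-⊑ (m ⊔ n))
            (normal (stage (m ⊔ n)) (xs , lift-left m n b) (ys , lift-right m n b′)
                    (trek-⊇ (stage-verts (m ⊔ n)) p))

    closed-normal-tree : (∀ x → Star _~_ root x) → (S : Vertex → List Vertex) →
      Σ BranchTree λ T → Normal′ T × (∀ {v s} → v ∈ verts T → s ∈ₗ S v → s ∈ verts T)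
    closed-normal-tree connect S = limit , limit-normal , limit-closed
      where open Growth.Closure connect S

    -- From branches to rooted trees.

    module Rooted (T : BranchTree) where

      open BranchTree T hiding (verts)

      Edge : Rel Vertex ℓ
      Edge x y = Child x y ⊎ Child y x

      up : ∀ {x y} → x ≼ y → Star Edge x y
      up = map-Star (inj₁ ∘ proj₁) ∘ climb

      from-root : ∀ {x} → x ∈ verts T → Star Edge root x
      from-root (_ , b) = up (_ , b , root∈branch b)

      -- In the next two lemmas a walk avoiding s can neither enter the set of
      -- vertices above s, nor leave the set of vertices above a child y of s.
      stay-out : ∀ {s a b} (w : Star Edge a b) → ¬ s ∈ₗ vertices w → s ⋠ a → s ⋠ b
      stay-out ε              s∉w s⋠a = s⋠a
      stay-out (inj₁ a<c ◅ w) s∉w s⋠a = stay-out w (s∉w ∘ there) λ s≼c →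
        s⋠a (≼-child a<c s≼c λ { refl → s∉w (there (start∈vertices w)) })
      stay-out (inj₂ c<a ◅ w) s∉w s⋠a = stay-out w (s∉w ∘ there) λ s≼c →
        s⋠a (≼-trans s≼c (child-≼ c<a))

      parent-unique : ∀ {x y z} → Child x z → Child y z → x ≡ y
      parent-unique (_ , b) (_ , b′) = ∷-injectiveˡ (once b b′)

      stay-in : ∀ {s y a b} → Child s y → (w : Star Edge a b) → ¬ s ∈ₗ vertices w → y ≼ a → y ≼ b
      stay-in s<y ε              s∉w y≼a = y≼a
      stay-in s<y (inj₁ a<c ◅ w) s∉w y≼a = stay-in s<y w (s∉w ∘ there) (≼-trans y≼a (child-≼ a<c))
      stay-in s<y (inj₂ c<a ◅ w) s∉w y≼a = stay-in s<y w (s∉w ∘ there) (≼-child c<a y≼a λ where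
        refl → s∉w (there (subst (_∈ₗ vertices w) (parent-unique c<a s<y) (start∈vertices w))))

      -- Let the cycle start with `s`, `y` and end in `e`. If it ascends to `y`, it stays above `y`,
      -- and the closing edge forces `y` below its parent `s`. If it descends to `y`, it never gets
      -- above `s`, so `e` would have to be the parent of `s` too, hence equal to `y`.
      acyclic : ¬ Cycle Edge
      acyclic record { path = record { walk = ε } ; long = s≤s () }
      acyclic record { path = record { walk = _ ◅ ε } ; long = s≤s (s≤s ()) }
      acyclic record { path = record { walk = first ◅ w@(_ ◅ w′) ; unique = s≢w ∷ (y≢w′ ∷ _) }
                     ; closing = closing } = contradiction first closing
        where
        s∉w = λ s∈w → All.lookup s≢w s∈w refl
        y≢e = All.lookup y≢w′ (end∈vertices w′)

        y≼y : ∀ {x y} → Child x y → y ≼ y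
        y≼y (_ , b) = ≼-refl (_ , b)

        contradiction : Edge _ _ → Edge _ _ → _
        contradiction (inj₁ s<y) (inj₁ e<s) =
          child-⋠ s<y (≼-trans (stay-in s<y w s∉w (y≼y s<y)) (child-≼ e<s))
        contradiction (inj₁ s<y) (inj₂ s<e) =
          child-⋠ s<y (≼-child s<e (stay-in s<y w s∉w (y≼y s<y)) y≢e)
        contradiction (inj₂ y<s) (inj₁ e<s) = y≢e (parent-unique y<s e<s)
        contradiction (inj₂ y<s) (inj₂ s<e) = stay-out w s∉w (child-⋠ y<s) (child-≼ s<e)

      rooted-tree : RootedTree G
      rooted-tree = record
        { subgraph  = record
          { verts     = verts T
          ; edge      = Edge
          ; edge-sym  = swap-⊎
          ; edge⇒~    = [ child-~ , ~-sym ∘ child-~ ]′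
          ; edge⇒vert = [ ≼⇒verts ∘ child-≼ , (λ (_ , b) → _ , b) ]′
          }
        ; connected = (root , _ , root-branch)
                    , λ x∈T y∈T → proj₁ (to-path (reverse-Star swap-⊎ (from-root x∈T) ◅◅ from-root y∈T))
        ; acyclic   = acyclic
        ; root      = root
        ; root∈     = _ , root-branch
        }

      open RootedTree rooted-tree using (_≤_)

      -- A path from the root that missed `x` could not enter the set of vertices above `x`, by
      -- `stay-out`.
      ≼⇒≤ : ∀ {x y} → x ≼ y → x ≤ y
      ≼⇒≤ {x} x≼y@(_ , b , _) = P , stable λ x∉P →
        stay-out (walk P) x∉P (λ x≼root → x∉P (root∈P (≼-branch root-branch x≼root))) x≼y
        where
        P = proj₁ (to-path (from-root (_ , b)))

        root∈P : x ∈ₗ root ∷ [] → x ∈ᵖ P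
        root∈P (here refl) = start∈vertices (walk P)

      -- The walk is cut at its first visit to `y`.
      to-trek : ∀ {N : Pred Vertex ℓ} {x a y} → x ~ a → (w : Star _~_ a y) →
                (∀ {v} → v ∈ₗ vertices w → v ≢ y → v ∉ N) → Trek N x y
      to-trek e ε outside = last e
      to-trek {a = a} {y} e (f ◅ w) outside with em {a ≡ y}
      ... | yes refl = last e
      ... | no a≢y   = step e (outside (here refl) a≢y) (to-trek f w (outside ∘ there))

      normal′⇒normal : Normal′ T → Normal G rooted-tree
      normal′⇒normal normal record { walk = ε } (x≢x , _) = ⊥-elim (x≢x refl)
      normal′⇒normal normal record { walk = e ◅ w ; unique = x≢w ∷ _ } (_ , x∈T , y∈T , outside) =
        map-⊎ ≼⇒≤ ≼⇒≤ (normal x∈T y∈T (to-trek e w λ v∈w v≢y →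
          outside (there v∈w) (λ v≡x → All.lookup x≢w v∈w (sym v≡x)) v≢y))

    -- The down-closure of `U` in a normal tree.

    module Prune (T : BranchTree) {U : Pred Vertex ℓ} (inhabited : Satisfiable U)
                 (U⊆T : U ⊆ verts T) where

      open BranchTree T hiding (verts; Branch)

      ⌈U⌉ : Pred Vertex ℓ
      ⌈U⌉ x = ∃[ u ] u ∈ U × x ≼ u

      -- Since `⌈U⌉` is closed downwards, demanding it of the whole branch amounts to demanding it
      -- of the head, and makes `parent` immediate.
      prune : BranchTree
      prune = record
        { Branch      = λ zs → Branch T zs × All ⌈U⌉ zs
        ; root-branch = root-branch , (let u , u∈U = inhabited ; zs , b = U⊆T u∈U
                                       in u , u∈U , zs , b , root∈branch b) ∷ []
        ; root-only   = root-only ∘ proj₁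
        ; parent      = λ { (b , _ ∷ all) → let b′ , e = parent b in (b′ , all) , e }
        ; once        = λ (b , _) (b′ , _) → once b b′
        }

      prune⊑T : prune ⊑ T
      prune⊑T = proj₁

      verts⇒⌈U⌉ : verts prune ⊆ ⌈U⌉
      verts⇒⌈U⌉ (_ , _ , x∈⌈U⌉ ∷ _) = x∈⌈U⌉

      ⌈U⌉⇒verts : ⌈U⌉ ⊆ verts prune
      ⌈U⌉⇒verts (u , u∈U , x≼u) = let zs , b = ≼⇒verts x≼u in
        zs , b , All.tabulate λ i → u , u∈U , ≼-trans (zs , b , i) x≼u

      ≼⇒prune : ∀ {x y} → y ∈ ⌈U⌉ → x ≼ y → x ≼[ prune ] y
      ≼⇒prune y∈⌈U⌉ x≼y = let zs , b , all = ⌈U⌉⇒verts y∈⌈U⌉ in zs , (b , all) , ≼-branch b x≼y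

      module _ (normal : Normal′ T) where

        -- Normality compares `b` with `y`; if `y` is the lower one, then `x` and `y` both lie on
        -- the branch of `b`.
        via : ∀ {x b y} → x ≼ b → y ∈ verts T → Trek (verts T) b y → Comparable x y
        via x≼b@(_ , b , _) y∈T p =
          [ inj₁ ∘ ≼-trans x≼b , chain x≼b ]′ (normal (_ , b) y∈T p)

        -- The trek visits T in successively comparable vertices; those outside ⌈U⌉ all lie
        -- above x, because ⌈U⌉ is closed downwards.
        comparable : ∀ {x y} → x ∈ ⌈U⌉ → y ∈ verts T → Trek (verts prune) x y → Comparable x y
        comparable {x} {y} x∈⌈U⌉ y∈T = go (≼-refl (≼⇒verts (proj₂ (proj₂ x∈⌈U⌉)))) (inj₁ refl)
          where
          -- `b` is the last vertex of `T` visited before the current vertex `a`, or `a` itself.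
          Reaches : Rel Vertex ℓ
          Reaches b a = b ≡ a ⊎ (a ∉ verts T × Trek (verts T) b a)

          extend : ∀ {b a c} → Reaches b a → a ~ c → Trek (verts T) b c
          extend (inj₁ refl)      e = last e
          extend (inj₂ (a∉T , p)) e = join p a∉T (last e)

          go : ∀ {a b} → x ≼ b → Reaches b a → Trek (verts prune) a y → Comparable x y
          go x≼b r (last e) = via x≼b y∈T (extend r e)
          go x≼b r (step {y = c} e c∉ p) with em {c ∈ verts T}
          ... | no c∉T  = go x≼b (inj₂ (c∉T , extend r e)) p
          ... | yes c∈T with via x≼b c∈T (extend r e)
          ...   | inj₁ x≼c = go x≼c (inj₁ refl) p
          ...   | inj₂ c≼x = let u , u∈U , x≼u = x∈⌈U⌉
                             in ⊥-elim (c∉ (⌈U⌉⇒verts (u , u∈U , ≼-trans c≼x x≼u)))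

        prune-normal : Normal′ prune
        prune-normal x∈ y∈ p =
          map-⊎ (≼⇒prune (verts⇒⌈U⌉ y∈)) (≼⇒prune (verts⇒⌈U⌉ x∈))
                (comparable (verts⇒⌈U⌉ x∈) (verts-mono {prune} {T} prune⊑T y∈) p)

  -- Cofinality is restricted to inhabited `U` because the root of a tree lies below no element of
  -- an empty set.
  GoodTree : (G : Graph ℓ) → Pred (Graph.Vertex G) ℓ → RootedTree G → Set (suc ℓ)
  GoodTree G U T = IsStarBlockingTree G T U
                 × (Satisfiable U → ContainsCofinally G T U)
                 × FiniteNeighbourhoods G T

  -- A good tree from finite separators.

  module Construction (G : Graph ℓ) (root : Graph.Vertex G) {U : Pred (Graph.Vertex G) ℓ} where

    open Graph G renaming (sym to ~-sym)
    open Fans G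
    open InfiniteFan
    open Trees G root

    -- S v is a finite set separating v from U in G - v.
    module Separated
      (connect : ∀ x → Star _~_ root x) (inhabited : Satisfiable U) (S : Vertex → List Vertex)
      (separates : ∀ v → ¬ (∃[ u ] u ∈ U × u ≢ v × Star (Guarded (S v) v) v u))
      (T : BranchTree) (T-normal : Normal′ T)
      (T-closed : ∀ {v s} → v ∈ verts T → s ∈ₗ S v → s ∈ verts T) where

      open BranchTree T using (_≼_; ≼-refl; child-~; climb; below-finite)

      -- After its start the trek stays outside `T`, which contains `S t`.
      guard-trek : ∀ {t x y} → t ∈ verts T → Trek (verts T) x y → y ∉ verts T →
                   Star (Guarded (S t) t) x y
      guard-trek t∈T (last e)       y∉T = (e , ⊥-elim ∘ y∉T ∘ T-closed t∈T) ◅ ε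
      guard-trek t∈T (step e z∉T p) y∉T = (e , ⊥-elim ∘ z∉T ∘ T-closed t∈T) ◅ guard-trek t∈T p y∉T

      U⊆T : U ⊆ verts T
      U⊆T {u} u∈U = stable λ u∉T →
        let t , t∈T , p = exit (_ , BranchTree.root-branch T) u∉T (connect u)
        in separates t (u , u∈U , (λ u≡t → u∉T (subst (verts T) (sym u≡t) t∈T)) , guard-trek t∈T p u∉T)

      open Prune T inhabited U⊆T
      open Rooted prune using (rooted-tree; ≼⇒≤; normal′⇒normal)
      open RootedTree rooted-tree using (edge⇒~; edge⇒vert; edge-sym)

      -- `v` is included because separation says nothing about walks that end in `v` itself, should
      -- `v` be in `U`.
      below : Vertex → List Vertex
      below v = proj₁ (below-finite (v ∷ S v))

      ∈-below : ∀ {v x y} → y ∈ₗ v ∷ S v → x ≼ y → x ∈ₗ below v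
      ∈-below {v} y∈ x≼y = proj₂ (below-finite (v ∷ S v)) (_ , y∈ , x≼y)

      -- Otherwise the walk could be continued upwards in the tree to U, avoiding S v.
      separated : ∀ {v t} → t ∈ verts prune → Star (Guarded (S v) v) v t → t ∈ₗ below v
      separated {v} t∈T′ w = stable λ t∉ →
        let u , u∈U , t≼u = verts⇒⌈U⌉ t∈T′
        in separates v
             ( u , u∈U , (λ u≡v → t∉ (∈-below (here u≡v) t≼u))
             , w ◅◅ map-Star (λ (child , t≼b) →
                 child-~ child , λ b∈S → ⊥-elim (t∉ (∈-below (there b∈S) t≼b))) (climb t≼u))

      -- The last edge can be unguarded: if it enters `S v`, then `t` is in `below v` at once.
      separated-edge : ∀ {v a t} → t ∈ verts prune → Star (Guarded (S v) v) v a → a ~ t → t ∈ₗ below v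
      separated-edge t∈T′@(_ , b , _) w a~t = stable λ t∉ → t∉ (separated t∈T′
        (w ◅◅ ((a~t , λ t∈S → ⊥-elim (t∉ (∈-below (there t∈S) (≼-refl (_ , b))))) ◅ ε)))

      locally-finite : LocallyFinite G rooted-tree
      locally-finite {t} _ = below t , λ e → separated-edge (edge⇒vert (edge-sym e)) ε (edge⇒~ e)

      -- Each fan path meets `S v` away from `v` or, by separation, ends in `below v`; either
      -- happens for finitely many paths only.
      undominated : (R : Ray G (RootedTree.subgraph rooted-tree)) → Undominated G R
      undominated R v (F , on-R) = infinite F (finite-⊆ (λ {i} _ → cases i em)
        (finite-∪ (meets-finite F (S v)) (ends-in-finite F (below v))))
        where
        end∈T′ : ∀ i → end F i ∈ verts prune
        end∈T′ i = let n , eq = on-R i in subst (verts prune) (sym eq) (edge⇒vert (Ray.step R n))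

        cases : ∀ i → Dec (i ∈ Meets F (S v)) → i ∈ Meets F (S v) ⊎ end F i ∈ₗ below v
        cases i (yes meets) = inj₁ meets
        cases i (no avoids) = inj₂ (separated (end∈T′ i) (guarded-path F avoids))

      blocking : IsStarBlockingTree G rooted-tree U
      blocking = record
        { locallyFinite = locally-finite
        ; normal        = normal′⇒normal (prune-normal T-normal)
        ; contains      = λ u∈U → ⌈U⌉⇒verts (_ , u∈U , ≼-refl (U⊆T u∈U))
        ; undominated   = undominated
        }

      cofinal : ContainsCofinally G rooted-tree U
      cofinal = IsStarBlockingTree.contains blocking , λ t∈T′ →
        let u , u∈U , t≼u = verts⇒⌈U⌉ t∈T′
        in u , u∈U , ≼⇒≤ (≼⇒prune (u , u∈U , ≼-refl (U⊆T u∈U)) t≼u)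

      module _ {C : Pred Vertex ℓ} (component : IsComponent G (∁ (verts prune)) C) where

        open IsComponent component

        C-walk : ∀ {x y} → x ∈ C → y ∈ C → Star (Subgraph.edge (induced G C)) x y
        C-walk x∈C y∈C = walk (proj₂ connected x∈C y∈C)

        -- A neighbour outside the tree could be added to `C`, against maximality.
        neighbourhood⊆T′ : Neighbourhood G C ⊆ verts prune
        neighbourhood⊆T′ {v} (v∉C , c , c∈C , v~c) = stable λ v∉T′ →
          v∉C (maximal D [ C⊆X , (λ { refl → v∉T′ }) ]′ D-connected inj₁ (inj₂ refl))
          where
          D : Pred Vertex ℓ
          D x = x ∈ C ⊎ x ≡ v

          D-edge = Subgraph.edge (induced G D)
          D-sym  = Subgraph.edge-sym (induced G D)

          from-c : ∀ {x} → x ∈ D → Star D-edge c x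
          from-c (inj₁ x∈C)  = map-Star (λ (a , b , e) → inj₁ a , inj₁ b , e) (C-walk c∈C x∈C)
          from-c (inj₂ refl) = (inj₁ c∈C , inj₂ refl , ~-sym v~c) ◅ ε

          D-connected : Connected (induced G D)
          D-connected = (v , inj₂ refl) , λ x∈D y∈D →
            proj₁ (to-path (reverse-Star (λ {x} {y} → D-sym {x} {y}) (from-c x∈D) ◅◅ from-c y∈D))

        C-trek : ∀ {v c t} → v ~ c → c ∈ C → Star (Subgraph.edge (induced G C)) c t →
                 Trek (verts prune) v t
        C-trek e c∈C ε                     = last e
        C-trek e c∈C ((_ , d∈C , e′) ◅ w) = step e (C⊆X c∈C) (C-trek e′ d∈C w)

        neighbourhood-finite : Finite (Neighbourhood G C)
        neighbourhood-finite with em {∃[ t ] t ∈ C × t ∈ verts T}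
        ... | yes (t , t∈C , t∈T) = finite-⊆ below-t (below-finite (t ∷ []))
          where
          below-t : ∀ {v} → v ∈ Neighbourhood G C → ∃[ y ] y ∈ₗ t ∷ [] × v ≼ y
          below-t v∈N@(_ , c , c∈C , v~c) with verts⇒⌈U⌉ (neighbourhood⊆T′ v∈N)
          ... | v∈⌈U⌉@(u , u∈U , v≼u) with comparable T-normal v∈⌈U⌉ t∈T (C-trek v~c c∈C (C-walk c∈C t∈C))
          ...   | inj₁ v≼t = t , here refl , v≼t
          -- `t` is in `T` but was pruned, so it cannot lie below an element of `⌈U⌉`.
          ...   | inj₂ t≼v = ⊥-elim (C⊆X t∈C (⌈U⌉⇒verts (u , u∈U , BranchTree.≼-trans T t≼v v≼u)))
        ... | no ¬meets with em {Satisfiable (Neighbourhood G C)}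
        ...   | no empty = [] , λ {v} v∈N → ⊥-elim (empty (v , v∈N))
        -- `C` misses `T` and hence `S t`, so from one fixed neighbour `t` all the others are
        -- reached through `C` by guarded walks.
        ...   | yes (t , t∈N@(_ , c , c∈C , t~c)) = below t , λ v∈N@(_ , c′ , c′∈C , v~c′) →
          separated-edge (neighbourhood⊆T′ v∈N)
            ((t~c , avoid c∈C) ◅ map-Star (λ (_ , b∈C , e) → e , avoid b∈C) (C-walk c∈C c′∈C))
            (~-sym v~c′)
          where
          avoid : ∀ {x} → x ∈ C → x ∈ₗ S t → x ≡ t
          avoid x∈C x∈S = ⊥-elim (¬meets (_ , x∈C , T-closed
            (verts-mono {prune} {T} prune⊑T (neighbourhood⊆T′ t∈N)) x∈S))

      good-tree : ∃[ T′ ] GoodTree G U T′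
      good-tree = rooted-tree , blocking , (λ _ → cofinal) , λ C → neighbourhood-finite

  -- If no finite set separates `v` from `U`, then `fan` builds a star centred at `v`.
  separators : ∀ (G : Graph ℓ) U → ¬ StarAttachedTo G U → let open Fans G in
               ∀ v → ∃[ X ] ¬ (∃[ u ] u ∈ U × u ≢ v × Star (Guarded X v) v u)
  separators G U ¬star v = stable λ none → ¬star (v , fan λ X → stable λ ¬walk → none (X , ¬walk))
    where open Fans G

  -- Blocking trees from the absence of a star.

  module _ (G : Graph ℓ) (connected : Connected (whole G)) where

    open Graph G using (Vertex; _~_)

    connect : ∀ x y → Star _~_ x y
    connect x y = walk (proj₂ connected {x} {y} tt tt)

    root : Vertex
    root = proj₁ (proj₁ connected)

    inhabited-blocking-tree : ∀ {U} → Satisfiable U → ¬ StarAttachedTo G U → ∃[ T ] GoodTree G U T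
    inhabited-blocking-tree {U} inhabited ¬star =
      let sep = separators G U ¬star
          T , T-normal , T-closed = Trees.closed-normal-tree G root (connect root) (proj₁ ∘ sep)
      in Construction.Separated.good-tree G root (connect root) inhabited
           (proj₁ ∘ sep) (proj₂ ∘ sep) T T-normal T-closed

    -- All paths of such a fan would share their end `r`, which is not the centre, so there is at
    -- most one.
    no-star-at-singleton : ∀ r → ¬ StarAttachedTo G (_≡ r)
    no-star-at-singleton r (c , F , ends) = infinite (finite-subsingleton λ {i} {j} _ _ →
      stable λ i≢j → end≢c i (disjoint i≢j (end∈vertices (walk (path i)))
        (subst (_∈ᵖ path j) (trans (ends j) (sym (ends i))) (end∈vertices (walk (path j))))))
      where open InfiniteFan F

    -- Pruning to an empty set would delete even the root, so the tree is borrowed from another set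
    -- `W`, later the singleton of the root.
    good-tree-for-empty : ∀ {U W} → ¬ Satisfiable U → ∃[ T ] GoodTree G W T → ∃[ T ] GoodTree G U T
    good-tree-for-empty empty (T , blocking , _ , finite-neighbourhoods) =
      T , record
        { locallyFinite = locallyFinite
        ; normal        = normal
        ; contains      = λ u∈U → ⊥-elim (empty (_ , u∈U))
        ; undominated   = undominated
        } , (λ inhabited → ⊥-elim (empty inhabited)) , finite-neighbourhoods
      where open IsStarBlockingTree blocking

    blocking-tree : ∀ {U} → ¬ StarAttachedTo G U → ∃[ T ] GoodTree G U T
    blocking-tree {U} ¬star = cases em
      where
      cases : Dec (Satisfiable U) → ∃[ T ] GoodTree G U T
      cases (yes inhabited) = inhabited-blocking-tree inhabited ¬star
      cases (no empty)      = good-tree-for-empty empty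
        (inhabited-blocking-tree {_≡ root} (root , refl) (no-star-at-singleton root))

-- Only the decision whether a star exists takes place at level `suc ℓ`.
lower-em : ∀ {ℓ} → ExcludedMiddle (suc ℓ) → ExcludedMiddle ℓ
lower-em {ℓ} em {P} = map′ lower lift (em {Lift (suc ℓ) P})

theorem6 : ∀ {ℓ} → ExcludedMiddle (suc ℓ) →
    (G : Graph ℓ) → Connected (whole G) →
    (U : Pred (Graph.Vertex G) ℓ) →
    ((StarAttachedTo G U ⊎ (∃[ T ] IsStarBlockingTree G T U))
    × ¬ (StarAttachedTo G U × (∃[ T ] IsStarBlockingTree G T U)))
    × ((∃[ T ] IsStarBlockingTree G T U) →
    ∃[ T ] IsStarBlockingTree G T U
    × (Satisfiable U → ContainsCofinally G T U)
    × FiniteNeighbourhoods G T)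
theorem6 em G connected U =
  -- For the second assertion the given tree only rules out a star; the good tree is then built
  -- afresh.
  (dichotomy em , exclusive) , λ T → blocking-tree G connected λ star → exclusive (star , T)
  where
  open Classical (lower-em em)
  open Fans G using (exclusive)

  dichotomy : Dec (StarAttachedTo G U) → StarAttachedTo G U ⊎ (∃[ T ] IsStarBlockingTree G T U)
  dichotomy (yes star) = inj₁ star
  dichotomy (no ¬star) = let T , blocking , _ = blocking-tree G connected ¬star in inj₂ (T , blocking)
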